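{- Let $Y,Z$ be distinct propositional variables. Then $(Y\vee Z)^*\nvdash_{\mathtt{NI}^{2\vee}_{at}}Y\vee Z$, where $(Y\vee Z)^*=\forall X.(Y\supset X)\supset((Z\supset X)\supset X)$ with $X$ distinct from $Y,Z$.
   Context: $\mathtt{NI}^{2\vee}_{at}$ is the natural deduction system for the formulas $A::=X\mid A\supset B\mid A\vee B\mid\forall X.A$ ($X$ ranging over propositional variables) with the standard intuitionistic introduction and elimination rules for $\supset$ and $\vee$, the rule $\forall$I (from $A$ infer $\forall X.A$, provided $X$ is not free in the undischarged assumptions), and the atomic elimination rule $\forall$E$_{at}$: from $\forall X.A$ infer $A\llbracket Y/X\rrbracket$, where the witness $Y$ must be a propositional variable. $\Gamma\vdash_{\mathtt{NI}^{2\vee}_{at}}A$ means that $A$ is derivable from assumptions $\Gamma$ in this system. $(\cdot)^*$ is the Russell–Prawitz translation. -}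

module Defs where

open import Data.List using (List; _∷_; map)
open import Data.List.Membership.Propositional using (_∈_)
open import Data.Nat using (ℕ; zero; suc)

infixr 6 _∨_
infixr 5 _⊃_
infix  4 _⊢_

-- Formulas up to α-equivalence, with de Bruijn indices: under k quantifiers,
-- an index i ≥ k denotes the free propositional variable i - k, so there are
-- infinitely many free variables, named by ℕ.
data Formula : Set where
  var : ℕ → Formula
  _⊃_ : Formula → Formula → Formula
  _∨_ : Formula → Formula → Formula
  ∀′_ : Formula → Formula

lift : (ℕ → ℕ) → ℕ → ℕ
lift f zero    = zero
lift f (suc n) = suc (f n)

rename : (ℕ → ℕ) → Formula → Formula
rename f (var n) = var (f n)
rename f (A ⊃ B) = rename f A ⊃ rename f B
rename f (A ∨ B) = rename f A ∨ rename f B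
rename f (∀′ A)  = ∀′ rename (lift f) A

-- The new variable 0 does not occur free in ↑ A.
↑_ : Formula → Formula
↑ A = rename suc A

instantiate : ℕ → ℕ → ℕ
instantiate Y zero    = Y
instantiate Y (suc n) = n

-- The body A of ∀′ A with the bound variable replaced by the variable Y.
_⟦_⟧ : Formula → ℕ → Formula
A ⟦ Y ⟧ = rename (instantiate Y) A

-- Natural deduction for NI²∨ with atomic ∀-elimination. In ∀I, the shift of the
-- context expresses that the quantified variable is not free in the assumptions.
data _⊢_ (Γ : List Formula) : Formula → Set where
  ass  : ∀ {A} → A ∈ Γ → Γ ⊢ A
  ⊃I   : ∀ {A B} → A ∷ Γ ⊢ B → Γ ⊢ A ⊃ B
  ⊃E   : ∀ {A B} → Γ ⊢ A ⊃ B → Γ ⊢ A → Γ ⊢ B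
  ∨I₁  : ∀ {A B} → Γ ⊢ A → Γ ⊢ A ∨ B
  ∨I₂  : ∀ {A B} → Γ ⊢ B → Γ ⊢ A ∨ B
  ∨E   : ∀ {A B C} → Γ ⊢ A ∨ B → A ∷ Γ ⊢ C → B ∷ Γ ⊢ C → Γ ⊢ C
  ∀I   : ∀ {A} → map ↑_ Γ ⊢ A → Γ ⊢ ∀′ A
  ∀Eat : ∀ {A} → Γ ⊢ ∀′ A → (Y : ℕ) → Γ ⊢ A ⟦ Y ⟧

-- The Russell–Prawitz translation: (A ∨ B)* = ∀X.(A* ⊃ X) ⊃ ((B* ⊃ X) ⊃ X),
-- where X is not free in A*, B*.
_* : Formula → Formula
(var n) * = var n
(A ⊃ B) * = (A *) ⊃ (B *)
(A ∨ B) * = ∀′ (((↑ (A *)) ⊃ var 0) ⊃ (((↑ (B *)) ⊃ var 0) ⊃ var 0))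
(∀′ A)  * = ∀′ (A *)

{-# OPTIONS --safe #-}
module Submission where

-- Since ∀-elimination only ever produces variables, the system is sound for
-- Kripke models in which ∀ ranges over an arbitrary constant domain D of
-- upward closed sets of worlds, as long as D contains the values of the free
-- variables (lemma sound). D need not be closed under disjunction, and this
-- is what separates Y ∨ Z from its translation.
--
-- The countermodel (fork) has a root with two incomparable worlds, leaf true
-- and leaf false, above it, and D consists of the two singletons {leaf b}. Let
-- Y denote {leaf true} and Z denote {leaf false}. The root forces neither, so
-- it does not force Y ∨ Z. It forces (Y ⊃ X) ⊃ (Z ⊃ X) ⊃ X for both values of
-- X: each leaf forces Y or Z, so the two premises give X there, while at the
-- root one of the premises is Z ⊃ Y or Y ⊃ Z, which fails at a leaf.

open import Data.Bool using (Bool; true; false)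
open import Data.List using ([]; _∷_)
open import Data.List.Relation.Unary.All as All using (All; []; _∷_)
open import Data.List.Relation.Unary.All.Properties using (map⁺)
open import Data.Nat using (ℕ; zero; suc; _≟_)
open import Data.Sum as Sum using (_⊎_; inj₁; inj₂; [_,_]′)
open import Relation.Binary.PropositionalEquality
  using (_≡_; _≢_; refl; sym; cong; subst; ≢-sym)
open import Relation.Nullary using (¬_; does)
open import Relation.Nullary.Decidable using (dec-true; dec-false)
open import Defs

-- A Kripke frame with a constant domain D of propositions over which the
-- variables range; d at w says that the proposition d holds at the world w.
record Model : Set₁ where
  infix 4 _≼_
  field
    World   : Set
    _≼_     : World → World → Set
    ≼-refl  : ∀ {w} → w ≼ w
    ≼-trans : ∀ {u v w} → u ≼ v → v ≼ w → u ≼ w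
    D       : Set
    _at_    : D → World → Set
    at-mono : ∀ {d v w} → v ≼ w → d at v → d at w

module Forcing (M : Model) where
  open Model M

  Valuation : Set
  Valuation = ℕ → D

  -- The valuation for the scope of a quantifier: d is the value of the bound
  -- variable 0.
  infixr 5 _▸_
  _▸_ : D → Valuation → Valuation
  (d ▸ ρ) zero    = d
  (d ▸ ρ) (suc n) = ρ n

  -- Forcing. Since the domain is constant, ∀ needs no quantification over
  -- later worlds.
  infix 4 _,_⊩_
  _,_⊩_ : World → Valuation → Formula → Set
  w , ρ ⊩ var n = ρ n at w
  w , ρ ⊩ A ⊃ B = ∀ v → w ≼ v → v , ρ ⊩ A → v , ρ ⊩ B
  w , ρ ⊩ A ∨ B = (w , ρ ⊩ A) ⊎ (w , ρ ⊩ B)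
  w , ρ ⊩ ∀′ A  = ∀ d → w , d ▸ ρ ⊩ A

  ⊩-mono : ∀ A {ρ v w} → v ≼ w → v , ρ ⊩ A → w , ρ ⊩ A
  ⊩-mono (var n) p a = at-mono p a
  ⊩-mono (A ⊃ B) p f = λ u q → f u (≼-trans p q)
  ⊩-mono (A ∨ B) p   = Sum.map (⊩-mono A p) (⊩-mono B p)
  ⊩-mono (∀′ A)  p f = λ d → ⊩-mono A p (f d)

  -- σ is the pullback of ρ along f, pointwise because function
  -- extensionality is not assumed.
  Pullback : (ℕ → ℕ) → Valuation → Valuation → Set
  Pullback f ρ σ = ∀ n → σ n ≡ ρ (f n)

  lift-pullback : ∀ {f ρ σ} → Pullback f ρ σ →
                  ∀ d → Pullback (lift f) (d ▸ ρ) (d ▸ σ)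
  lift-pullback e d zero    = refl
  lift-pullback e d (suc n) = e n

  -- The two directions are mutually recursive because of the contravariance
  -- of ⊃.
  mutual
    rename⁺ : ∀ A {f ρ σ} → Pullback f ρ σ →
              ∀ {w} → w , σ ⊩ A → w , ρ ⊩ rename f A
    rename⁺ (var n) e {w} a = subst (_at w) (e n) a
    rename⁺ (A ⊃ B) e g     = λ v p a → rename⁺ B e (g v p (rename⁻ A e a))
    rename⁺ (A ∨ B) e       = Sum.map (rename⁺ A e) (rename⁺ B e)
    rename⁺ (∀′ A)  e g     = λ d → rename⁺ A (lift-pullback e d) (g d)

    rename⁻ : ∀ A {f ρ σ} → Pullback f ρ σ →
              ∀ {w} → w , ρ ⊩ rename f A → w , σ ⊩ A
    rename⁻ (var n) e {w} a = subst (_at w) (sym (e n)) a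
    rename⁻ (A ⊃ B) e g     = λ v p a → rename⁻ B e (g v p (rename⁺ A e a))
    rename⁻ (A ∨ B) e       = Sum.map (rename⁻ A e) (rename⁻ B e)
    rename⁻ (∀′ A)  e g     = λ d → rename⁻ A (lift-pullback e d) (g d)

  instantiate-pullback : ∀ Y ρ → Pullback (instantiate Y) ρ (ρ Y ▸ ρ)
  instantiate-pullback Y ρ zero    = refl
  instantiate-pullback Y ρ (suc n) = refl

  sound : ∀ {Γ A} → Γ ⊢ A → ∀ {w ρ} → All (w , ρ ⊩_) Γ → w , ρ ⊩ A
  sound (ass x)      γ = All.lookup γ x
  sound (⊃I t)       γ = λ v p a → sound t (a ∷ All.map (λ {A} → ⊩-mono A p) γ)
  sound (⊃E t s)     γ = sound t γ _ ≼-refl (sound s γ)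
  sound (∨I₁ t)      γ = inj₁ (sound t γ)
  sound (∨I₂ t)      γ = inj₂ (sound t γ)
  sound (∨E t r s)   γ =
    [ (λ a → sound r (a ∷ γ)) , (λ b → sound s (b ∷ γ)) ]′ (sound t γ)
  sound (∀I t)       γ = λ d →
    sound t (map⁺ (All.map (λ {A} → rename⁺ A (λ _ → refl)) γ))
  -- The witness is a variable, so its value lies in D.
  sound (∀Eat {A} t Y) {ρ = ρ} γ =
    rename⁺ A (instantiate-pullback Y ρ) (sound t γ (ρ Y))

data Node : Set where
  root : Node
  leaf : Bool → Node

data _⊑_ : Node → Node → Set where
  root⊑  : ∀ {w} → root ⊑ w
  ⊑-refl : ∀ {w} → w ⊑ w

⊑-trans : ∀ {u v w} → u ⊑ v → v ⊑ w → u ⊑ w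
⊑-trans root⊑  q = root⊑
⊑-trans ⊑-refl q = q

leaf-maximal : ∀ {b v w} → v ⊑ w → v ≡ leaf b → w ≡ leaf b
leaf-maximal ⊑-refl e = e

-- The domain is Bool, where b stands for the singleton {leaf b}.
fork : Model
fork = record
  { World   = Node
  ; _≼_     = _⊑_
  ; ≼-refl  = ⊑-refl
  ; ≼-trans = ⊑-trans
  ; D       = Bool
  ; _at_    = λ b w → w ≡ leaf b
  ; at-mono = leaf-maximal
  }

open Forcing fork

root⊮∨ : ∀ {ρ} Y Z → ¬ (root , ρ ⊩ var Y ∨ var Z)
root⊮∨ Y Z (inj₁ ())
root⊮∨ Y Z (inj₂ ())

root⊩* : ∀ {ρ} Y Z → ρ Y ≡ true → ρ Z ≡ false →
         root , ρ ⊩ (var Y ∨ var Z) *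
root⊩* Y Z y z c     v p f (leaf true)  q g =
  f (leaf true) q (cong leaf (sym y))
root⊩* Y Z y z c     v p f (leaf false) q g =
  g (leaf false) ⊑-refl (cong leaf (sym z))
-- At the root with X denoting {leaf true}, the premise Z ⊃ X fails at leaf false.
root⊩* Y Z y z true  v p f root q g
  with () ← g (leaf false) root⊑ (cong leaf (sym z))
-- With X denoting {leaf false}, the premise Y ⊃ X fails at leaf true.
root⊩* Y Z y z false v p f root q g
  with () ← f (leaf true) (⊑-trans q root⊑) (cong leaf (sym y))

proposition6 : (Y Z : ℕ) → Y ≢ Z → ¬ (((var Y ∨ var Z) *) ∷ [] ⊢ var Y ∨ var Z)
proposition6 Y Z Y≢Z t =
  root⊮∨ Y Z (sound t {ρ = ρ} (root⊩* Y Z ρY ρZ ∷ []))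
  where
  -- Y denotes {leaf true} and every other variable denotes {leaf false}.
  ρ : Valuation
  ρ n = does (n ≟ Y)

  ρY : ρ Y ≡ true
  ρY = dec-true (Y ≟ Y) refl

  ρZ : ρ Z ≡ false
  ρZ = dec-false (Z ≟ Y) (≢-sym Y≢Z)
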